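{- There exists a real $\theta>\log_2 3$ such that $\pi(\vec T_k,\theta)=1$ for all integers $k\ge 4$.
   Context: A partially directed $k$-graph ($k$-PDG) on a vertex set $V$ specifies for each $k$-subset $S\subseteq V$ exactly one of: no edge on $S$; an undirected edge on $S$; or a directed edge on $S$ directed toward a chosen vertex of $S$. For an $n$-vertex $k$-PDG $\vec H$, $\alpha(\vec H)=e_u(\vec H)/\binom nk$ and $\beta(\vec H)=e_d(\vec H)/\binom nk$ where $e_u,e_d$ count undirected and directed edges. $\vec F$ is a subgraph of $\vec H$ if a $k$-PDG isomorphic to $\vec F$ can be obtained from $\vec H$ by deleting edges, deleting vertices and forgetting directions of edges; $\vec H$ is $\vec F$-free otherwise. $\vec T_k$ is the $k$-PDG on $\{1,\dots,k+1\}$ with undirected edges $\{1,\dots,k\}$, $\{2,\dots,k+1\}$ and the edge $\{1,\dots,k-1,k+1\}$ directed toward $k+1$. $\pi(\vec F,\theta)$ is the smallest real number such that every $n$-vertex $\vec F$-free $k$-PDG $\vec H$ satisfies $\alpha(\vec H)+\theta\beta(\vec H)\le\pi(\vec F,\theta)+o_{n\to\infty}(1)$. -}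

module Defs where

open import Data.Nat as ℕ using (ℕ; zero; suc; _^_)
open import Data.Nat.Combinatorics using (_C_)
open import Data.Integer using (+_)
open import Data.Rational as ℚ using (ℚ; _/_; 0ℚ; 1ℚ)
open import Data.Fin using (Fin; zero; suc; inject₁; fromℕ)
open import Data.Fin.Properties using (any?)
open import Data.Fin.Subset using (Subset; _∈_; ∣_∣)
open import Data.Vec using (Vec; []; _∷_; tabulate)
open import Data.List using (List; []; _∷_; _++_; map)
open import Data.Bool using (Bool; true; false)
open import Data.Product using (Σ; ∃; _×_; _,_)
open import Function.Definitions using (Injective)
open import Relation.Nullary using (¬_; does)
open import Relation.Binary.PropositionalEquality using (_≡_)
import Data.Fin as F

-- Possible state of a set S: no edge, undirected edge, or edge directed toward a vertex.
data EType (n : ℕ) : Set where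
  none : EType n
  und  : EType n
  dir  : Fin n → EType n

record PDG (k n : ℕ) : Set where
  field
    edge     : Subset n → EType n
    onlyK    : ∀ S → ¬ (∣ S ∣ ≡ k) → edge S ≡ none
    headIn   : ∀ S v → edge S ≡ dir v → v ∈ S
open PDG public

allSubsets : (n : ℕ) → List (Subset n)
allSubsets zero = [] ∷ []
allSubsets (suc n) = map (true ∷_) (allSubsets n) ++ map (false ∷_) (allSubsets n)

countB : ∀ {A : Set} → (A → Bool) → List A → ℕ
countB p [] = 0
countB p (x ∷ xs) with p x
... | true  = suc (countB p xs)
... | false = countB p xs

isUnd : ∀ {n} → EType n → Bool
isUnd und = true
isUnd _   = false

isDir : ∀ {n} → EType n → Bool
isDir (dir _) = true
isDir _       = false

eu : ∀ {k n} → PDG k n → ℕ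
eu {n = n} H = countB (λ S → isUnd (edge H S)) (allSubsets n)

ed : ∀ {k n} → PDG k n → ℕ
ed {n = n} H = countB (λ S → isDir (edge H S)) (allSubsets n)

image : ∀ {m n} → (Fin m → Fin n) → Subset n
image {m} {n} f = tabulate (λ v → does (any? (λ i → f i F.≟ v)))

-- the maps Fin k → Fin (k+1) whose images are the three edges of T_k
-- (vertices 1..k+1 of the paper are 0..k here)
-- {1,...,k} ↦ {0..k-1}; {2,...,k+1} ↦ {1..k}; {1,...,k-1,k+1} ↦ {0..k-2,k}
eA : ∀ {k} → Fin k → Fin (suc k)
eA = inject₁

eB : ∀ {k} → Fin k → Fin (suc k)
eB = suc

eC : ∀ {k} → Fin k → Fin (suc k)
eC {suc zero} zero = suc zero
eC {suc (suc k)} zero = zero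
eC {suc (suc k)} (suc i) = suc (eC i)

HasEdge : ∀ {n} → EType n → Set
HasEdge e = ¬ (e ≡ none)

-- T_k is a subgraph of H: an injective placement f of the k+1 vertices such that
-- the two undirected edges of T_k land on edges of H (direction may be forgotten)
-- and the directed edge lands on an edge of H directed toward f(k+1).
ContainsT : (k : ℕ) → ∀ {n} → PDG k n → Set
ContainsT k {n} H =
  Σ (Fin (suc k) → Fin n) λ f →
    Injective _≡_ _≡_ f ×
    HasEdge (edge H (image (λ i → f (eA i)))) ×
    HasEdge (edge H (image (λ i → f (eB i)))) ×
    (edge H (image (λ i → f (eC i))) ≡ dir (f (fromℕ k)))

TFree : (k : ℕ) → ∀ {n} → PDG k n → Set
TFree k H = ¬ ContainsT k H

ℕtoℚ : ℕ → ℚ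
ℕtoℚ m = + m / 1

-- c is an asymptotic upper bound for α + θβ over T_k-free k-PDGs:
-- for every ε > 0, for all large n, every T_k-free H satisfies
-- e_u + θ e_d ≤ (c + ε) * C(n,k)   (i.e. α + θβ ≤ c + ε)
UpperBound : (k : ℕ) → (θ c : ℚ) → Set
UpperBound k θ c =
  ∀ (ε : ℚ) → 0ℚ ℚ.< ε →
    ∃ λ N → ∀ n → N ℕ.≤ n → (H : PDG k n) → TFree k H →
      ℕtoℚ (eu H) ℚ.+ θ ℚ.* ℕtoℚ (ed H) ℚ.≤ (c ℚ.+ ε) ℚ.* ℕtoℚ (n C k)

PiEqOne : (k : ℕ) → (θ : ℚ) → Set
PiEqOne k θ = UpperBound k θ 1ℚ × (∀ c → UpperBound k θ c → 1ℚ ℚ.≤ c)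

Log₂3< : ℚ → Set
Log₂3< θ = Σ ℕ λ p → Σ ℕ λ q → (θ ≡ + p / suc q) × (3 ^ suc q ℕ.< 2 ^ p)

{-# OPTIONS --safe #-}
-- Take θ = 8/5.  For a (k-1)-set L let f(L) count the vertices a with L + a directed toward a, and
-- ν(L) those with L + a a non-edge.  Summing ((3k - 5) f - 5 ν)² ≥ 0 over all L and regrouping the
-- pairs of added vertices a ≠ c by the (k+1)-set X = L + a + c reduces the theorem, up to a diagonal
-- error of lower order, to an inequality about each single X.  If some edge X - c is directed toward
-- an a such that X - a is also an edge, T_k-freeness leaves X no third edge; otherwise every
-- directed edge of X is directed toward a vertex whose removal gives a non-edge.  The inequality
-- holds in both cases.  Complete undirected graphs show that 1 is optimal.
module Submission where

open import Defs
open import Data.Bool using (Bool; true; false; not; _∧_; if_then_else_)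
import Data.Bool as Bool
open import Data.Bool.Properties using (not-involutive)
open import Data.Fin using (Fin; zero; suc; inject₁; fromℕ)
import Data.Fin as F
open import Data.Fin.Properties using (any?)
import Data.Fin.Properties as Fin
open import Data.Fin.Relation.Unary.Top using (view; ‵fromℕ; ‵inject₁)
open import Data.Fin.Subset using (Subset; ∣_∣)
import Data.Integer as ℤ
import Data.Integer.Properties as ℤ
open import Data.List using (List; []; _∷_; _++_; map; allFin)
import Data.List.Properties as List
open import Data.Nat using (ℕ; zero; suc; _+_; _*_; _^_; _≤_; z≤n; s≤s; _≟_; _<?_; NonZero)
open import Data.Nat.Combinatorics using (_C_; nCn≡1; nCk≡nC[n∸k]; nCk+nC[k+1]≡[n+1]C[k+1])
open import Data.Nat.Coprimality using (Coprime)
open import Data.Nat.ListAction using (sum)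
open import Data.Nat.ListAction.Properties using (sum-++)
open import Data.Nat.Properties hiding (_≟_; _<?_)
open import Data.Nat.Tactic.RingSolver using (solve-∀)
open import Data.Product using (Σ; ∃; _×_; _,_)
open import Data.Rational as ℚ using (ℚ; mkℚ; 1ℚ; toℚᵘ)
import Data.Rational.Properties as ℚ
open import Data.Rational.Unnormalised as ℚᵘ using (mkℚᵘ; *≤*)
import Data.Rational.Unnormalised.Properties as ℚᵘ
open import Data.Sum using (inj₁; inj₂)
open import Data.Vec using ([]; _∷_; lookup; updateAt)
import Data.Vec.Functional as Fun
import Data.Vec.Properties as Vec
open import Function using (_∘_; id; case_of_)
open import Function.Definitions using (Injective)
open import Relation.Binary.PropositionalEquality
open import Relation.Nullary using (does; yes; no; contradiction)
open import Relation.Nullary.Decidable using (_×-dec_; dec-true; dec-false; from-yes)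

-- With θ = 8/5 the claim amounts to 3 e_d ≤ 5 e_0 up to lower order, where e_0 counts the
-- non-edges. Averaging this over (k+1)-sets X alone fails: if X - a is the only non-edge in X and
-- the other k subsets are all directed toward a, then X spans no T_k, yet 3k > 5. The mixed terms f
-- ν of the squares pay for such an X. With ν weighted by 5 and the averaged claim scaled by 10k, 3k
-- - 5 is the least weight of f that pays in full: 30k² = 50k + 10(3k - 5)k. It must not be much
-- larger, since its square multiplies the pairs of edges X - c and X - a directed toward a and c.

private
  variable
    A B : Set
    m n : ℕ

-- Finite sums and zero-one indicators

∑ : List A → (A → ℕ) → ℕ
∑ xs g = sum (map g xs)

∑ᶠ : (Fin n → ℕ) → ℕ
∑ᶠ {n} = ∑ (allFin n)

∑ˢ : (Subset n → ℕ) → ℕ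
∑ˢ {n} = ∑ (allSubsets n)

∑-cong : (xs : List A) {g h : A → ℕ} → (∀ x → g x ≡ h x) → ∑ xs g ≡ ∑ xs h
∑-cong xs eq = cong sum (List.map-cong eq xs)

∑-mono : (xs : List A) {g h : A → ℕ} → (∀ x → g x ≤ h x) → ∑ xs g ≤ ∑ xs h
∑-mono []       le = z≤n
∑-mono (x ∷ xs) le = +-mono-≤ (le x) (∑-mono xs le)

∑-+ : (xs : List A) (g h : A → ℕ) → ∑ xs (λ x → g x + h x) ≡ ∑ xs g + ∑ xs h
∑-+ []       g h = refl
∑-+ (x ∷ xs) g h rewrite ∑-+ xs g h = interchange (g x) (h x) (∑ xs g) (∑ xs h)
  where
  interchange : ∀ a b c d → (a + b) + (c + d) ≡ (a + c) + (b + d)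
  interchange = solve-∀

∑-*ˡ : (xs : List A) (r : ℕ) (g : A → ℕ) → ∑ xs (λ x → r * g x) ≡ r * ∑ xs g
∑-*ˡ []       r g = sym (*-zeroʳ r)
∑-*ˡ (x ∷ xs) r g rewrite ∑-*ˡ xs r g = sym (*-distribˡ-+ r (g x) (∑ xs g))

∑-*ʳ : (xs : List A) (g : A → ℕ) (r : ℕ) → ∑ xs (λ x → g x * r) ≡ ∑ xs g * r
∑-*ʳ []       g r = refl
∑-*ʳ (x ∷ xs) g r rewrite ∑-*ʳ xs g r = sym (*-distribʳ-+ r (g x) (∑ xs g))

∑-0 : (xs : List A) → ∑ xs (λ _ → 0) ≡ 0
∑-0 []       = refl
∑-0 (_ ∷ xs) = ∑-0 xs

∑-swap : (xs : List A) (ys : List B) (g : A → B → ℕ) →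
         ∑ xs (λ x → ∑ ys (g x)) ≡ ∑ ys (λ y → ∑ xs (λ x → g x y))
∑-swap []       ys g = sym (∑-0 ys)
∑-swap (x ∷ xs) ys g rewrite ∑-swap xs ys g = sym (∑-+ ys (g x) _)

∑-++ : (xs ys : List A) (g : A → ℕ) → ∑ (xs ++ ys) g ≡ ∑ xs g + ∑ ys g
∑-++ xs ys g rewrite List.map-++ g xs ys = sum-++ (map g xs) (map g ys)

∑-map : (f : A → B) (xs : List A) (g : B → ℕ) → ∑ (map f xs) g ≡ ∑ xs (g ∘ f)
∑-map f xs g = cong sum (sym (List.map-∘ xs))

ι : Bool → ℕ
ι true  = 1
ι false = 0

ι≤1 : ∀ b → ι b ≤ 1
ι≤1 true  = s≤s z≤n
ι≤1 false = z≤n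

ι-idem : ∀ b → ι b * ι b ≡ ι b
ι-idem true  = refl
ι-idem false = refl

ι*≤ : ∀ b m → ι b * m ≤ m
ι*≤ true  m = ≤-reflexive (*-identityˡ m)
ι*≤ false m = z≤n

countB≡∑ : (p : A → Bool) (xs : List A) → countB p xs ≡ ∑ xs (ι ∘ p)
countB≡∑ p []       = refl
countB≡∑ p (x ∷ xs) with p x
... | true  = cong suc (countB≡∑ p xs)
... | false = countB≡∑ p xs

δ : Fin n → Fin n → ℕ
δ a c = ι (does (a F.≟ c))

-- A factor instead of a filtered index list: sums over pairs a ≠ c stay plain double sums, whose
-- order can be exchanged.
δ̄ : Fin n → Fin n → ℕ
δ̄ a c = ι (not (does (a F.≟ c)))

∑ᶠ-suc : (g : Fin (suc n) → ℕ) → ∑ᶠ g ≡ g zero + ∑ᶠ (g ∘ suc)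
∑ᶠ-suc {n} g = cong (g zero +_)
  (trans (cong (λ xs → ∑ xs g) (sym (List.map-tabulate id suc))) (∑-map suc (allFin n) g))

∑ᶠ-pick : (a : Fin n) (g : Fin n → ℕ) → ∑ᶠ g ≡ g a + ∑ᶠ (λ c → δ̄ a c * g c)
∑ᶠ-pick zero g
  rewrite ∑ᶠ-suc g | ∑ᶠ-suc (λ c → δ̄ zero c * g c) =
  cong (g zero +_) (∑-cong (allFin _) (λ c → sym (*-identityˡ (g (suc c)))))
∑ᶠ-pick (suc a) g
  rewrite ∑ᶠ-suc g | ∑ᶠ-suc (λ c → δ̄ (suc a) c * g c) | ∑ᶠ-pick a (g ∘ suc) =
  rearrange (g zero) (g (suc a)) _
  where
  rearrange : ∀ x y z → x + (y + z) ≡ y + (x + 0 + z)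
  rearrange = solve-∀

term≤∑ᶠ : (a : Fin n) (g : Fin n → ℕ) → g a ≤ ∑ᶠ g
term≤∑ᶠ a g = ≤-trans (m≤m+n (g a) _) (≤-reflexive (sym (∑ᶠ-pick a g)))

∑ᶠ-δ : (a : Fin n) → ∑ᶠ (δ a) ≡ 1
∑ᶠ-δ {suc n} zero = trans (∑ᶠ-suc {n} (δ zero)) (cong suc (∑-0 (allFin n)))
∑ᶠ-δ (suc a)      = trans (∑ᶠ-suc (δ (suc a))) (∑ᶠ-δ a)

∑ᶠ-const : ∀ r → ∑ᶠ {n} (λ _ → r) ≡ n * r
∑ᶠ-const {zero}  r = refl
∑ᶠ-const {suc n} r = trans (∑ᶠ-suc {n} (λ _ → r)) (cong (r +_) (∑ᶠ-const {n} r))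

-- Splits off the diagonal. When g = h takes only the values zero and one, the diagonal is `∑ᶠ g`,
-- of lower order than the pairs.
∑ᶠ-product : (g h : Fin n → ℕ) →
  ∑ᶠ g * ∑ᶠ h ≡ ∑ᶠ (λ a → g a * h a) + ∑ᶠ (λ a → ∑ᶠ (λ c → δ̄ a c * (g a * h c)))
∑ᶠ-product {n} g h = begin
  ∑ᶠ g * ∑ᶠ h
    ≡⟨ ∑-*ʳ (allFin n) g (∑ᶠ h) ⟨
  ∑ᶠ (λ a → g a * ∑ᶠ h)
    ≡⟨ ∑-cong (allFin n) row ⟩
  ∑ᶠ (λ a → g a * h a + ∑ᶠ (λ c → δ̄ a c * (g a * h c)))
    ≡⟨ ∑-+ (allFin n) _ _ ⟩
  ∑ᶠ (λ a → g a * h a) + ∑ᶠ (λ a → ∑ᶠ (λ c → δ̄ a c * (g a * h c))) ∎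
  where
  open ≡-Reasoning
  rearrange : ∀ x y z → x * (y * z) ≡ y * (x * z)
  rearrange = solve-∀
  row : ∀ a → g a * ∑ᶠ h ≡ g a * h a + ∑ᶠ (λ c → δ̄ a c * (g a * h c))
  row a = begin
    g a * ∑ᶠ h
      ≡⟨ cong (g a *_) (∑ᶠ-pick a h) ⟩
    g a * (h a + ∑ᶠ (λ c → δ̄ a c * h c))
      ≡⟨ *-distribˡ-+ (g a) (h a) _ ⟩
    g a * h a + g a * ∑ᶠ (λ c → δ̄ a c * h c)
      ≡⟨ cong (g a * h a +_) (∑-*ˡ (allFin n) (g a) _) ⟨
    g a * h a + ∑ᶠ (λ c → g a * (δ̄ a c * h c))
      ≡⟨ cong (g a * h a +_) (∑-cong (allFin n) (λ c → rearrange (g a) (δ̄ a c) (h c))) ⟩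
    g a * h a + ∑ᶠ (λ c → δ̄ a c * (g a * h c)) ∎

-- Sums over subsets

-- Stands for both S + a and S - a; the factors `out` and `mem` say which is meant. As an involution
-- on all subsets it provides every change of variables below.
tog : Fin n → Subset n → Subset n
tog a S = updateAt S a not

tog-involutive : (a : Fin n) (S : Subset n) → tog a (tog a S) ≡ S
tog-involutive a S = trans (Vec.updateAt-updateAt a S)
  (trans (Vec.updateAt-cong a not-involutive S) (Vec.updateAt-id a S))

tog-comm : {a c : Fin n} → a ≢ c → (S : Subset n) → tog a (tog c S) ≡ tog c (tog a S)
tog-comm {a = a} {c} a≢c S = Vec.updateAt-commutes a c a≢c S

lookup-tog : (a : Fin n) (S : Subset n) → lookup (tog a S) a ≡ not (lookup S a)
lookup-tog a S = Vec.lookup∘updateAt a S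

lookup-tog-≢ : {a c : Fin n} → a ≢ c → (S : Subset n) → lookup (tog c S) a ≡ lookup S a
lookup-tog-≢ {a = a} {c} a≢c S = Vec.lookup∘updateAt′ a c a≢c S

∣tog∣ : (a : Fin n) (S : Subset n) → lookup S a ≡ true → ∣ S ∣ ≡ suc ∣ tog a S ∣
∣tog∣ zero    (true  ∷ S) refl = refl
∣tog∣ (suc a) (true  ∷ S) eq   = cong suc (∣tog∣ a S eq)
∣tog∣ (suc a) (false ∷ S) eq   = ∣tog∣ a S eq

∑ˢ-suc : (g : Subset (suc n) → ℕ) → ∑ˢ g ≡ ∑ˢ (g ∘ (true ∷_)) + ∑ˢ (g ∘ (false ∷_))
∑ˢ-suc {n} g = trans (∑-++ (map (true ∷_) (allSubsets n)) _ g)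
  (cong₂ _+_ (∑-map (true ∷_) (allSubsets n) g) (∑-map (false ∷_) (allSubsets n) g))

∑ˢ-tog : (a : Fin n) (g : Subset n → ℕ) → ∑ˢ g ≡ ∑ˢ (g ∘ tog a)
∑ˢ-tog zero g
  rewrite ∑ˢ-suc g | ∑ˢ-suc (g ∘ tog zero) = +-comm (∑ˢ (g ∘ (true ∷_))) _
∑ˢ-tog (suc a) g
  rewrite ∑ˢ-suc g | ∑ˢ-suc (g ∘ tog (suc a)) =
  cong₂ _+_ (∑ˢ-tog a (g ∘ (true ∷_))) (∑ˢ-tog a (g ∘ (false ∷_)))

mem : Fin n → Subset n → ℕ
mem a S = ι (lookup S a)

out : Fin n → Subset n → ℕ
out a S = ι (not (lookup S a))

mem-tog : (a : Fin n) (S : Subset n) → mem a (tog a S) ≡ out a S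
mem-tog a S = cong ι (lookup-tog a S)

out-tog : (a : Fin n) (S : Subset n) → out a (tog a S) ≡ mem a S
out-tog a S = cong ι (trans (cong not (lookup-tog a S)) (not-involutive _))

∑-mem : (S : Subset n) → ∑ᶠ (λ a → mem a S) ≡ ∣ S ∣
∑-mem []          = refl
∑-mem (true  ∷ S) = trans (∑ᶠ-suc (λ a → mem a (true ∷ S))) (cong suc (∑-mem S))
∑-mem (false ∷ S) = trans (∑ᶠ-suc (λ a → mem a (false ∷ S))) (∑-mem S)

∑-mem-out : (S : Subset n) → ∣ S ∣ + ∑ᶠ (λ a → out a S) ≡ n
∑-mem-out []          = refl
∑-mem-out (true  ∷ S) = cong suc
  (trans (cong (∣ S ∣ +_) (∑ᶠ-suc (λ a → out a (true ∷ S)))) (∑-mem-out S))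
∑-mem-out (false ∷ S) = trans
  (cong (∣ S ∣ +_) (∑ᶠ-suc (λ a → out a (false ∷ S))))
  (trans (+-suc ∣ S ∣ _) (cong suc (∑-mem-out S)))

-- Both sides count incidences between L and S = L + a; toggling a exchanges `out` and `mem`.
∑ˢ-add : (g : Subset n → Fin n → ℕ) →
  ∑ˢ (λ L → ∑ᶠ (λ a → out a L * g (tog a L) a)) ≡ ∑ˢ (λ S → ∑ᶠ (λ a → mem a S * g S a))
∑ˢ-add {n} g = begin
  ∑ˢ (λ L → ∑ᶠ (λ a → out a L * g (tog a L) a))
    ≡⟨ ∑-swap (allSubsets n) (allFin n) _ ⟩
  ∑ᶠ (λ a → ∑ˢ (λ L → out a L * g (tog a L) a))
    ≡⟨ ∑-cong (allFin n) (λ a → trans (∑ˢ-tog a _) (∑-cong (allSubsets n) (λ S →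
         cong₂ _*_ (out-tog a S) (cong (λ T → g T a) (tog-involutive a S))))) ⟩
  ∑ᶠ (λ a → ∑ˢ (λ S → mem a S * g S a))
    ≡⟨ ∑-swap (allFin n) (allSubsets n) _ ⟩
  ∑ˢ (λ S → ∑ᶠ (λ a → mem a S * g S a)) ∎
  where open ≡-Reasoning

∑ˢ-remove : (g : Subset n → ℕ) →
  ∑ˢ (λ X → ∑ᶠ (λ c → mem c X * g (tog c X))) ≡ ∑ˢ (λ S → ∑ᶠ (λ c → out c S) * g S)
∑ˢ-remove {n} g = begin
  ∑ˢ (λ X → ∑ᶠ (λ c → mem c X * g (tog c X)))
    ≡⟨ ∑-swap (allSubsets n) (allFin n) _ ⟩
  ∑ᶠ (λ c → ∑ˢ (λ X → mem c X * g (tog c X)))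
    ≡⟨ ∑-cong (allFin n) (λ c → trans (∑ˢ-tog c _) (∑-cong (allSubsets n) (λ S →
         cong₂ _*_ (mem-tog c S) (cong g (tog-involutive c S))))) ⟩
  ∑ᶠ (λ c → ∑ˢ (λ S → out c S * g S))
    ≡⟨ ∑-swap (allFin n) (allSubsets n) _ ⟩
  ∑ˢ (λ S → ∑ᶠ (λ c → out c S * g S))
    ≡⟨ ∑-cong (allSubsets n) (λ S → ∑-*ʳ (allFin n) _ (g S)) ⟩
  ∑ˢ (λ S → ∑ᶠ (λ c → out c S) * g S) ∎
  where open ≡-Reasoning

-- With X = L + a + c, so that L + a = X - c and L + c = X - a, both sums run over the same pairs.

pairsAbove : (p q : Subset n → Fin n → ℕ) → Subset n → ℕ
pairsAbove p q L =
  ∑ᶠ (λ a → ∑ᶠ (λ c → δ̄ a c * ((out a L * p (tog a L) a) * (out c L * q (tog c L) c))))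

pairsBelow : (p q : Subset n → Fin n → ℕ) → Subset n → ℕ
pairsBelow p q X =
  ∑ᶠ (λ a → ∑ᶠ (λ c → δ̄ a c * ((mem a X * p (tog c X) a) * (mem c X * q (tog a X) c))))

∑ˢ-pairs : (p q : Subset n → Fin n → ℕ) → ∑ˢ (pairsAbove p q) ≡ ∑ˢ (pairsBelow p q)
∑ˢ-pairs {n} p q = begin
  ∑ˢ (pairsAbove p q)
    ≡⟨ ∑-swap (allSubsets n) (allFin n) _ ⟩
  ∑ᶠ (λ a → ∑ˢ (λ L → ∑ᶠ (λ c → above a c L)))
    ≡⟨ ∑-cong (allFin n) (λ a → ∑-swap (allSubsets n) (allFin n) _) ⟩
  ∑ᶠ (λ a → ∑ᶠ (λ c → ∑ˢ (above a c)))
    ≡⟨ ∑-cong (allFin n) (λ a → ∑-cong (allFin n) (λ c → move a c)) ⟩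
  ∑ᶠ (λ a → ∑ᶠ (λ c → ∑ˢ (below a c)))
    ≡⟨ ∑-cong (allFin n) (λ a → ∑-swap (allFin n) (allSubsets n) _) ⟩
  ∑ᶠ (λ a → ∑ˢ (λ X → ∑ᶠ (λ c → below a c X)))
    ≡⟨ ∑-swap (allFin n) (allSubsets n) _ ⟩
  ∑ˢ (pairsBelow p q) ∎
  where
  open ≡-Reasoning
  above below : Fin n → Fin n → Subset n → ℕ
  above a c L = δ̄ a c * ((out a L * p (tog a L) a) * (out c L * q (tog c L) c))
  below a c X = δ̄ a c * ((mem a X * p (tog c X) a) * (mem c X * q (tog a X) c))
  move : ∀ a c → ∑ˢ (above a c) ≡ ∑ˢ (below a c)
  move a c with a F.≟ c
  ... | yes _  = trans (∑-0 (allSubsets n)) (sym (∑-0 (allSubsets n)))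
  -- The substitution L = X - a - c. As a ≠ c, the toggles commute and neither affects membership of
  -- the other vertex.
  ... | no a≢c = trans (∑ˢ-tog a _) (trans (∑ˢ-tog c _) (∑-cong (allSubsets n) pointwise))
    where
    pointwise : ∀ X → 1 * ((out a (tog a (tog c X)) * p (tog a (tog a (tog c X))) a) *
                           (out c (tog a (tog c X)) * q (tog c (tog a (tog c X))) c))
                    ≡ 1 * ((mem a X * p (tog c X) a) * (mem c X * q (tog a X) c))
    pointwise X
      rewrite tog-involutive a (tog c X) | tog-comm a≢c X | tog-involutive c (tog a X)
            | out-tog c (tog a X) | sym (tog-comm a≢c X) | out-tog a (tog c X)
            | lookup-tog-≢ a≢c X | lookup-tog-≢ (≢-sym a≢c) X = refl

nC0≡1 : ∀ n → n C 0 ≡ 1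
nC0≡1 n = trans (nCk≡nC[n∸k] {n = n} z≤n) (nCn≡1 n)

∑ˢ-size : ∀ n k → ∑ˢ {n} (λ S → ι (does (∣ S ∣ ≟ k))) ≡ n C k
∑ˢ-size zero    zero    = refl
∑ˢ-size zero    (suc k) = refl
∑ˢ-size (suc n) zero    = trans (∑ˢ-suc {n} (λ S → ι (does (∣ S ∣ ≟ 0))))
  (cong₂ _+_ (∑-0 (allSubsets n)) (trans (∑ˢ-size n 0) (trans (nC0≡1 n) (sym (nC0≡1 (suc n))))))
∑ˢ-size (suc n) (suc k) = begin
  ∑ˢ {suc n} (λ S → ι (does (∣ S ∣ ≟ suc k)))
    ≡⟨ ∑ˢ-suc {n} (λ S → ι (does (∣ S ∣ ≟ suc k))) ⟩
  ∑ˢ {n} (λ S → ι (does (∣ S ∣ ≟ k))) + ∑ˢ {n} (λ S → ι (does (∣ S ∣ ≟ suc k)))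
    ≡⟨ cong₂ _+_ (∑ˢ-size n k) (∑ˢ-size n (suc k)) ⟩
  n C k + n C suc k
    ≡⟨ nCk+nC[k+1]≡[n+1]C[k+1] n k ⟩
  suc n C suc k ∎
  where open ≡-Reasoning

-- Copies of T_k

-- These properties imply `image f ≡ S` and, unlike that equation, extend readily when a vertex is
-- added at either end of f.
record Enumerates (f : Fin m → Fin n) (S : Subset n) : Set where
  field
    injective : Injective _≡_ _≡_ f
    sound     : ∀ i → lookup S (f i) ≡ true
    complete  : ∀ v → lookup S v ≡ true → ∃ λ i → f i ≡ v
open Enumerates

enumerates-cong : {f g : Fin m → Fin n} {S : Subset n} →
                  (∀ i → f i ≡ g i) → Enumerates g S → Enumerates f S
enumerates-cong {f = f} {g} {S} eq e = record
  { injective = λ {i} {j} p → injective e (trans (sym (eq i)) (trans p (eq j)))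
  ; sound     = λ i → trans (cong (lookup S) (eq i)) (sound e i)
  ; complete  = λ v v∈S → let i , p = complete e v v∈S in i , trans (eq i) p
  }

image-enumerates : {f : Fin m → Fin n} {S : Subset n} → Enumerates f S → image f ≡ S
image-enumerates {f = f} {S} e = trans (Vec.tabulate-cong pointwise) (Vec.tabulate∘lookup S)
  where
  pointwise : ∀ v → does (any? (λ i → f i F.≟ v)) ≡ lookup S v
  pointwise v with any? (λ i → f i F.≟ v) | lookup S v in v∈S
  ... | yes _          | true  = refl
  ... | no _           | false = refl
  ... | yes (i , refl) | false = trans (sym (sound e i)) v∈S
  ... | no ∄i          | true  = contradiction (complete e v v∈S) ∄i

tog-false : (a : Fin n) (S : Subset n) → lookup S a ≡ true → lookup (tog a S) a ≡ false
tog-false a S a∈S = trans (lookup-tog a S) (cong not a∈S)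

∈tog⇒≢ : {a v : Fin n} (S : Subset n) → lookup S a ≡ true → lookup (tog a S) v ≡ true → v ≢ a
∈tog⇒≢ {a = a} S a∈S v∈ refl with trans (sym v∈) (tog-false a S a∈S)
... | ()

∈tog⇒∈ : {a v : Fin n} (S : Subset n) → lookup S a ≡ true → lookup (tog a S) v ≡ true →
         lookup S v ≡ true
∈tog⇒∈ S a∈S v∈ = trans (sym (lookup-tog-≢ (∈tog⇒≢ S a∈S v∈) S)) v∈

enumerates-∷ : {g : Fin m → Fin n} {S : Subset n} {b : Fin n} → lookup S b ≡ true →
               Enumerates g (tog b S) → Enumerates (b Fun.∷ g) S
enumerates-∷ {g = g} {S} {b} b∈S e = record { injective = inj ; sound = snd ; complete = cmp }
  where
  g≢b : ∀ i → g i ≢ b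
  g≢b i = ∈tog⇒≢ S b∈S (sound e i)
  inj : Injective _≡_ _≡_ (b Fun.∷ g)
  inj {zero}  {zero}  _ = refl
  inj {zero}  {suc j} p = contradiction (sym p) (g≢b j)
  inj {suc i} {zero}  p = contradiction p (g≢b i)
  inj {suc i} {suc j} p = cong suc (injective e p)
  snd : ∀ i → lookup S ((b Fun.∷ g) i) ≡ true
  snd zero    = b∈S
  snd (suc i) = ∈tog⇒∈ S b∈S (sound e i)
  cmp : ∀ v → lookup S v ≡ true → ∃ λ i → (b Fun.∷ g) i ≡ v
  cmp v v∈S with v F.≟ b
  ... | yes refl = zero , refl
  ... | no v≢b   = let i , p = complete e v (trans (lookup-tog-≢ v≢b S) v∈S) in suc i , p

-- The edges of T_k omit its last vertex (`eA`), its first (`eB`) or its last but one (`eC`), so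
-- enumerations must grow at both ends: by `Fun.∷` in front, by `snoc` at the back.
snoc : (Fin m → A) → A → Fin (suc m) → A
snoc {zero}  g x _       = x
snoc {suc m} g x zero    = g zero
snoc {suc m} g x (suc i) = snoc (g ∘ suc) x i

snoc-inject₁ : (g : Fin m → A) (x : A) (i : Fin m) → snoc g x (inject₁ i) ≡ g i
snoc-inject₁ g x zero    = refl
snoc-inject₁ g x (suc i) = snoc-inject₁ (g ∘ suc) x i

snoc-fromℕ : (g : Fin m → A) (x : A) → snoc g x (fromℕ m) ≡ x
snoc-fromℕ {zero}  g x = refl
snoc-fromℕ {suc m} g x = snoc-fromℕ (g ∘ suc) x

snoc-eC : (g : Fin m → A) (x y : A) (i : Fin (suc m)) → snoc (snoc g x) y (eC i) ≡ snoc g y i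
snoc-eC {zero}  g x y zero    = refl
snoc-eC {suc m} g x y zero    = refl
snoc-eC {suc m} g x y (suc i) = snoc-eC (g ∘ suc) x y i

enumerates-snoc : {g : Fin m → Fin n} {S : Subset n} {b : Fin n} → lookup S b ≡ true →
                  Enumerates g (tog b S) → Enumerates (snoc g b) S
enumerates-snoc {m} {g = g} {S} {b} b∈S e = record { injective = inj ; sound = snd ; complete = cmp }
  where
  g≢b : ∀ i → g i ≢ b
  g≢b i = ∈tog⇒≢ S b∈S (sound e i)
  inj : Injective _≡_ _≡_ (snoc g b)
  inj {i} {j} p with view i | view j
  ... | ‵fromℕ     | ‵fromℕ     = refl
  ... | ‵fromℕ     | ‵inject₁ j =
    contradiction (trans (sym (snoc-inject₁ g b j)) (trans (sym p) (snoc-fromℕ g b))) (g≢b j)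
  ... | ‵inject₁ i | ‵fromℕ     =
    contradiction (trans (sym (snoc-inject₁ g b i)) (trans p (snoc-fromℕ g b))) (g≢b i)
  ... | ‵inject₁ i | ‵inject₁ j = cong inject₁
    (injective e (trans (sym (snoc-inject₁ g b i)) (trans p (snoc-inject₁ g b j))))
  snd : ∀ i → lookup S (snoc g b i) ≡ true
  snd i with view i
  ... | ‵fromℕ     = trans (cong (lookup S) (snoc-fromℕ g b)) b∈S
  ... | ‵inject₁ i = trans (cong (lookup S) (snoc-inject₁ g b i)) (∈tog⇒∈ S b∈S (sound e i))
  cmp : ∀ v → lookup S v ≡ true → ∃ λ i → snoc g b i ≡ v
  cmp v v∈S with v F.≟ b
  ... | yes refl = fromℕ m , snoc-fromℕ g b
  ... | no v≢b   =
    let i , p = complete e v (trans (lookup-tog-≢ v≢b S) v∈S) in inject₁ i , trans (snoc-inject₁ g b i) p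

enumerate : (S : Subset n) → ∃ λ (f : Fin ∣ S ∣ → Fin n) → Enumerates f S
enumerate [] = (λ ()) , record { injective = λ { {()} } ; sound = λ () ; complete = λ () }
enumerate (false ∷ S) = let f , e = enumerate S in suc ∘ f , record
  { injective = injective e ∘ Fin.suc-injective
  ; sound     = sound e
  ; complete  = λ { (suc v) v∈S → let i , p = complete e v v∈S in i , cong suc p }
  }
enumerate (true ∷ S) = let f , e = enumerate S in
  zero Fun.∷ (suc ∘ f) , record
  { injective = λ { {zero} {zero} _ → refl
                  ; {suc i} {suc j} p → cong suc (injective e (Fin.suc-injective p)) }
  ; sound     = λ { zero → refl ; (suc i) → sound e i }
  ; complete  = λ { zero _ → zero , refl
                  ; (suc v) v∈S → let i , p = complete e v v∈S in suc i , cong suc p }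
  }

-- In the copy of T_k, b is the first vertex, c the last but one and a the last; the other vertices
-- of X may come in any order between b and c.
containsT : ∀ {k} (H : PDG k n) (X : Subset n) {a b c : Fin n} → ∣ X ∣ ≡ suc k →
  lookup X a ≡ true → lookup X b ≡ true → lookup X c ≡ true → b ≢ a → b ≢ c → a ≢ c →
  edge H (tog c X) ≡ dir a → HasEdge (edge H (tog a X)) → HasEdge (edge H (tog b X)) →
  ContainsT k H
containsT {n} {k} H X {a} {b} {c} ∣X∣ a∈X b∈X c∈X b≢a b≢c a≢c X-c→a X-a X-b =
  go (suc-injective (trans (sym ∣X∣) ∣X∣≡)) H X-c→a X-a X-b
  where
  R : Subset n
  R = tog a (tog b (tog c X))
  a≢b : a ≢ b
  a≢b = ≢-sym b≢a
  c≢a : c ≢ a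
  c≢a = ≢-sym a≢c
  keep : ∀ {x y} → x ≢ y → lookup X x ≡ true → lookup (tog y X) x ≡ true
  keep x≢y x∈X = trans (lookup-tog-≢ x≢y X) x∈X
  keep₂ : ∀ {x y z} → x ≢ y → x ≢ z → lookup X x ≡ true → lookup (tog y (tog z X)) x ≡ true
  keep₂ {z = z} x≢y x≢z x∈X = trans (lookup-tog-≢ x≢y (tog z X)) (keep x≢z x∈X)
  ∣X∣≡ : ∣ X ∣ ≡ suc (suc (suc ∣ R ∣))
  ∣X∣≡ = trans (∣tog∣ c X c∈X) (cong suc (trans (∣tog∣ b (tog c X) (keep b≢c b∈X))
    (cong suc (∣tog∣ a (tog b (tog c X)) (keep₂ a≢b a≢c a∈X)))))
  -- `k` is made a variable again so that matching `refl` can replace it by `suc (suc ∣ R ∣)`, which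
  -- gives `f` the required domain.
  go : ∀ {k} → k ≡ suc (suc ∣ R ∣) → (H : PDG k n) → edge H (tog c X) ≡ dir a →
       HasEdge (edge H (tog a X)) → HasEdge (edge H (tog b X)) → ContainsT k H
  go refl H X-c→a X-a X-b =
    f , injective enumX
      , subst (HasEdge ∘ edge H) (sym (image-enumerates enumA)) X-a
      , subst (HasEdge ∘ edge H) (sym (image-enumerates enumB)) X-b
      , trans (cong (edge H) (image-enumerates enumC))
              (trans X-c→a (cong dir (sym (snoc-fromℕ (snoc g c) a))))
    where
    g : Fin ∣ R ∣ → Fin n
    g = let g , _ = enumerate R in g
    enumR : Enumerates g R
    enumR = let _ , e = enumerate R in e
    f : Fin (suc (suc (suc ∣ R ∣))) → Fin n
    f = b Fun.∷ snoc (snoc g c) a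
    -- The three edges strip X down to R in different orders; commuting the toggles reconciles them.
    enumB : Enumerates (snoc (snoc g c) a) (tog b X)
    enumB = enumerates-snoc (keep a≢b a∈X) (enumerates-snoc (keep₂ c≢a (≢-sym b≢c) c∈X)
      (subst (Enumerates g) (trans (cong (tog a) (tog-comm b≢c X)) (tog-comm a≢c (tog b X))) enumR))
    enumX : Enumerates f X
    enumX = enumerates-∷ b∈X enumB
    enumA : Enumerates (f ∘ eA) (tog a X)
    enumA = enumerates-cong (λ { zero → refl ; (suc i) → snoc-inject₁ (snoc g c) a i })
      (enumerates-∷ (keep b≢a b∈X) (enumerates-snoc (keep₂ (≢-sym b≢c) c≢a c∈X)
        (subst (Enumerates g) (trans (cong (tog a) (tog-comm b≢c X))
          (trans (tog-comm a≢c (tog b X)) (cong (tog c) (tog-comm a≢b X)))) enumR)))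
    enumC : Enumerates (f ∘ eC) (tog c X)
    enumC = enumerates-cong (λ { zero → refl ; (suc i) → snoc-eC g c a i })
      (enumerates-∷ (keep b≢c b∈X) (enumerates-snoc (keep₂ a≢b a≢c a∈X) enumR))

-- The local inequality

-- The square (w f - 5 ν)² expanded, with its mixed term moved across because ℕ has no subtraction.
-- Naming the difference of the two terms d makes d² the slack.
weighted-AM-GM : ∀ w f ν → 10 * w * (f * ν) ≤ w * w * (f * f) + 25 * (ν * ν)
weighted-AM-GM w f ν = subst₂ _≤_ (lhs w f ν) (rhs w f ν) (2xy≤x²+y² (w * f) (5 * ν))
  where
  square : ∀ x d → 2 * (x * (x + d)) + d * d ≡ x * x + (x + d) * (x + d)
  square = solve-∀
  square′ : ∀ x d → 2 * ((x + d) * x) + d * d ≡ (x + d) * (x + d) + x * x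
  square′ = solve-∀
  2xy≤x²+y² : ∀ x y → 2 * (x * y) ≤ x * x + y * y
  2xy≤x²+y² x y with ≤-total x y
  ... | inj₁ x≤y with m≤n⇒∃[o]m+o≡n x≤y
  ...   | d , refl = m+n≤o⇒m≤o _ (≤-reflexive (square x d))
  2xy≤x²+y² x y | inj₂ y≤x with m≤n⇒∃[o]m+o≡n y≤x
  ...   | d , refl = m+n≤o⇒m≤o _ (≤-reflexive (square′ y d))
  lhs : ∀ w f ν → 2 * (w * f * (5 * ν)) ≡ 10 * w * (f * ν)
  lhs = solve-∀
  rhs : ∀ w f ν → w * f * (w * f) + 5 * ν * (5 * ν) ≡ w * w * (f * f) + 25 * (ν * ν)
  rhs = solve-∀

-- Turns m² = m + nn into nn = m (m - 1); the successor avoids truncated subtraction.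
square-minus : ∀ m {s} → suc m * suc m ≡ suc m + s → s ≡ suc m * m
square-minus m {s} eq = +-cancelˡ-≡ (suc m) s (suc m * m) (trans (sym eq) (*-suc (suc m) m))

-- Here k = 4 + t and 3k - 5 = 7 + 3t.  For a (k+1)-set X with m non-edges and e directed edges,
-- ff, fn, nn are the numbers of ordered pairs a ≠ c in X such that X - c is directed toward a and X - a
-- toward c; X - c is directed toward a and X - a is a non-edge; X - a and X - c are non-edges.
Balanced : (t m e ff fn nn : ℕ) → Set
Balanced t m e ff fn nn =
  30 * (4 + t) * e + (7 + 3 * t) * (7 + 3 * t) * ff + 25 * nn ≤ 50 * (4 + t) * m + 10 * (7 + 3 * t) * fn

-- Almost all k-subsets of X are non-edges, so 50 k m exceeds 25 nn by about 25 k², whereas ff ≤ 2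
-- costs only about 18 k².
balanced-fewEdges : ∀ t m d e {ff} fn nn → m + d ≡ 5 + t → d ≤ 2 → e ≤ d → ff ≤ e → m * m ≡ m + nn →
  Balanced t m e ff fn nn
balanced-fewEdges t m d e {ff} fn nn m+d d≤2 e≤d ff≤e m² = begin
  30 * (4 + t) * e + (7 + 3 * t) * (7 + 3 * t) * ff + 25 * nn
    ≤⟨ +-monoˡ-≤ (25 * nn) (+-mono-≤ (*-monoʳ-≤ (30 * (4 + t)) e≤2)
         (*-monoʳ-≤ ((7 + 3 * t) * (7 + 3 * t)) (≤-trans ff≤e e≤2))) ⟩
  30 * (4 + t) * 2 + (7 + 3 * t) * (7 + 3 * t) * 2 + 25 * nn
    ≤⟨ main d d≤2 m+d ⟩
  50 * (4 + t) * m
    ≤⟨ m≤m+n _ _ ⟩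
  50 * (4 + t) * m + 10 * (7 + 3 * t) * fn ∎
  where
  open ≤-Reasoning
  e≤2 : e ≤ 2
  e≤2 = ≤-trans e≤d d≤2
  finish : ∀ p → m ≡ suc p → ∀ r →
    30 * (4 + t) * 2 + (7 + 3 * t) * (7 + 3 * t) * 2 + 25 * (suc p * p) + r ≡ 50 * (4 + t) * suc p →
    30 * (4 + t) * 2 + (7 + 3 * t) * (7 + 3 * t) * 2 + 25 * nn ≤ 50 * (4 + t) * m
  finish p refl r eq rewrite square-minus p {nn} m² = m+n≤o⇒m≤o _ (≤-reflexive eq)
  cancel : ∀ d {m'} → m + d ≡ m' + d → m ≡ m'
  cancel d eq = +-cancelʳ-≡ d m _ eq
  -- The cases m = k + 1, k and k - 1. Each slack is a polynomial in t = k - 4 with natural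
  -- coefficients, the leading one being 7 = 25 - 18.
  p₀ : ∀ t → 30 * (4 + t) * 2 + (7 + 3 * t) * (7 + 3 * t) * 2 + 25 * ((5 + t) * (4 + t))
           + (162 + 81 * t + 7 * (t * t)) ≡ 50 * (4 + t) * (5 + t)
  p₀ = solve-∀
  p₁ : ∀ t → 30 * (4 + t) * 2 + (7 + 3 * t) * (7 + 3 * t) * 2 + 25 * ((4 + t) * (3 + t))
           + (162 + 81 * t + 7 * (t * t)) ≡ 50 * (4 + t) * (4 + t)
  p₁ = solve-∀
  p₂ : ∀ t → 30 * (4 + t) * 2 + (7 + 3 * t) * (7 + 3 * t) * 2 + 25 * ((3 + t) * (2 + t))
           + (112 + 81 * t + 7 * (t * t)) ≡ 50 * (4 + t) * (3 + t)
  p₂ = solve-∀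
  main : ∀ d → d ≤ 2 → m + d ≡ 5 + t →
    30 * (4 + t) * 2 + (7 + 3 * t) * (7 + 3 * t) * 2 + 25 * nn ≤ 50 * (4 + t) * m
  main 0 _ eq = finish (4 + t) (trans (sym (+-identityʳ m)) eq) _ (p₀ t)
  main 1 _ eq = finish (3 + t) (cancel 1 (trans eq (+-comm 1 (4 + t)))) _ (p₁ t)
  main 2 _ eq = finish (2 + t) (cancel 2 (trans eq (+-comm 2 (3 + t)))) _ (p₂ t)
  main (suc (suc (suc _))) (s≤s (s≤s ())) _

-- Serves the sets X of the wrong size and, in the next lemma, those without non-edges.
balanced-empty : ∀ t m {e ff} fn nn → m ≡ 0 → e ≡ 0 → ff ≤ e → m * m ≡ m + nn → Balanced t m e ff fn nn
balanced-empty t m fn nn refl refl z≤n refl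
  rewrite *-zeroʳ (30 * (4 + t)) | *-zeroʳ ((7 + 3 * t) * (7 + 3 * t)) = z≤n

-- The term in fn pays for 10(3k - 5) e out of 30 k e, which leaves 50 e. For m ≥ 1 the rest, 50 e +
-- 25 m (m - 1) ≤ 50 k m, follows from k = (m - 1) + e + u. For m = 0, the bound fn ≤ n m excludes
-- directed edges.
balanced-headsOnNonEdges : ∀ t n m e u {ff} fn nn → m + (e + u) ≡ 5 + t → ff ≡ 0 →
  e ≤ fn → fn ≤ n * m → m * m ≡ m + nn → Balanced t m e ff fn nn
balanced-headsOnNonEdges t n zero e u fn nn _ ff≡0 e≤fn fn≤nm m² = balanced-empty t 0 fn nn refl e≡0
  (≤-reflexive (trans ff≡0 (sym e≡0))) m²
  where
  e≡0 : e ≡ 0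
  e≡0 = n≤0⇒n≡0 (≤-trans e≤fn (≤-trans fn≤nm (≤-reflexive (*-zeroʳ n))))
balanced-headsOnNonEdges t n (suc i) e u fn nn total refl e≤fn _ m²
  rewrite square-minus i {nn} m² | *-zeroʳ ((7 + 3 * t) * (7 + 3 * t)) = begin
  30 * (4 + t) * e + 0 + 25 * (suc i * i)
    ≡⟨ split t e (25 * (suc i * i)) ⟩
  (50 * e + 25 * (suc i * i)) + 10 * (7 + 3 * t) * e
    ≤⟨ +-mono-≤ (m+n≤o⇒m≤o (50 * e + 25 * (suc i * i)) (≤-reflexive (slack i e u)))
         (*-monoʳ-≤ (10 * (7 + 3 * t)) e≤fn) ⟩
  50 * (i + (e + u)) * suc i + 10 * (7 + 3 * t) * fn
    ≡⟨ cong (λ k → 50 * k * suc i + 10 * (7 + 3 * t) * fn) (suc-injective total) ⟩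
  50 * (4 + t) * suc i + 10 * (7 + 3 * t) * fn ∎
  where
  open ≤-Reasoning
  split : ∀ t e s → 30 * (4 + t) * e + 0 + s ≡ (50 * e + s) + 10 * (7 + 3 * t) * e
  split = solve-∀
  slack : ∀ i e u → 50 * e + 25 * (suc i * i) + (25 * (suc i * i) + 50 * (e * i) + 50 * (u * suc i))
                  ≡ 50 * (i + (e + u)) * suc i
  slack = solve-∀

-- Edge counts inside one vertex set

isNone : ∀ {n} → EType n → Bool
isNone none = true
isNone _    = false

pointsTo : ∀ {n} → EType n → Fin n → Bool
pointsTo (dir v) a = does (v F.≟ a)
pointsTo _       _ = false

pointsTo⇒≡dir : ∀ {n} (e : EType n) {a} → pointsTo e a ≡ true → e ≡ dir a
pointsTo⇒≡dir (dir v) {a} eq with v F.≟ a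
... | yes refl = refl

isNone≡false⇒HasEdge : ∀ {n} {e : EType n} → isNone e ≡ false → HasEdge e
isNone≡false⇒HasEdge () refl

module _ {k n : ℕ} (H : PDG k n) where

  -- The size test matters: edge H S is none also when S is not a k-set.
  sizeK nonEdge directed undirected : Subset n → ℕ
  sizeK S      = ι (does (∣ S ∣ ≟ k))
  nonEdge S    = ι (does (∣ S ∣ ≟ k) ∧ isNone (edge H S))
  directed S   = ι (isDir (edge H S))
  undirected S = ι (isUnd (edge H S))

  -- `missing` has the shape of `headAt` so that the same pair sums apply to heads, to non-edges and
  -- to mixtures of both.
  headAt missing : Subset n → Fin n → ℕ
  headAt S a  = ι (pointsTo (edge H S) a)
  missing S _ = nonEdge S

  trichotomy : ∀ S → nonEdge S + (directed S + undirected S) ≡ sizeK S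
  trichotomy S with ∣ S ∣ ≟ k
  ... | no ≢k rewrite onlyK H S ≢k | dec-false (∣ S ∣ ≟ k) ≢k = refl
  ... | yes ≡k rewrite dec-true (∣ S ∣ ≟ k) ≡k with edge H S
  ...   | none  = refl
  ...   | und   = refl
  ...   | dir _ = refl

  ∑-headAt : ∀ S → ∑ᶠ (headAt S) ≡ directed S
  ∑-headAt S with edge H S
  ... | none  = ∑-0 (allFin n)
  ... | und   = ∑-0 (allFin n)
  ... | dir v = ∑ᶠ-δ v

  -- The k-subsets of X are indexed by the vertex c that they omit. All three counts vanish unless X
  -- has k + 1 elements, so later sums may run over all X.
  nonEdges directeds undirecteds : Subset n → ℕ
  nonEdges X    = ∑ᶠ (λ c → mem c X * nonEdge (tog c X))
  directeds X   = ∑ᶠ (λ c → mem c X * directed (tog c X))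
  undirecteds X = ∑ᶠ (λ c → mem c X * undirected (tog c X))

  edges≡ : ∀ X → ∑ᶠ (λ c → mem c X * (directed (tog c X) + undirected (tog c X)))
               ≡ directeds X + undirecteds X
  edges≡ X = trans (∑-cong (allFin n) (λ c → *-distribˡ-+ (mem c X) _ _)) (∑-+ (allFin n) _ _)

  total : ∀ X → nonEdges X + (directeds X + undirecteds X) ≡ ∑ᶠ (λ c → mem c X * sizeK (tog c X))
  total X = begin
    nonEdges X + (directeds X + undirecteds X)
      ≡⟨ cong (nonEdges X +_) (edges≡ X) ⟨
    nonEdges X + ∑ᶠ (λ c → mem c X * (directed (tog c X) + undirected (tog c X)))
      ≡⟨ ∑-+ (allFin n) _ _ ⟨
    ∑ᶠ (λ c → mem c X * nonEdge (tog c X) + mem c X * (directed (tog c X) + undirected (tog c X)))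
      ≡⟨ ∑-cong (allFin n) (λ c → trans (sym (*-distribˡ-+ (mem c X) _ _))
           (cong (mem c X *_) (trichotomy (tog c X)))) ⟩
    ∑ᶠ (λ c → mem c X * sizeK (tog c X)) ∎
    where open ≡-Reasoning

  sizeK-tog : ∀ X c → lookup X c ≡ true → sizeK (tog c X) ≡ ι (does (∣ X ∣ ≟ suc k))
  sizeK-tog X c c∈X rewrite ∣tog∣ c X c∈X = refl

  total-size : ∀ X → nonEdges X + (directeds X + undirecteds X) ≡ ∣ X ∣ * ι (does (∣ X ∣ ≟ suc k))
  total-size X = begin
    nonEdges X + (directeds X + undirecteds X)
      ≡⟨ total X ⟩
    ∑ᶠ (λ c → mem c X * sizeK (tog c X))
      ≡⟨ ∑-cong (allFin n) pointwise ⟩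
    ∑ᶠ (λ c → mem c X * ι (does (∣ X ∣ ≟ suc k)))
      ≡⟨ ∑-*ʳ (allFin n) _ _ ⟩
    ∑ᶠ (λ c → mem c X) * ι (does (∣ X ∣ ≟ suc k))
      ≡⟨ cong (_* ι (does (∣ X ∣ ≟ suc k))) (∑-mem X) ⟩
    ∣ X ∣ * ι (does (∣ X ∣ ≟ suc k)) ∎
    where
    open ≡-Reasoning
    pointwise : ∀ c → mem c X * sizeK (tog c X) ≡ mem c X * ι (does (∣ X ∣ ≟ suc k))
    pointwise c with lookup X c in c∈X
    ... | true  = cong (1 *_) (sizeK-tog X c c∈X)
    ... | false = refl

  nonEdges² : ∀ X → nonEdges X * nonEdges X ≡ nonEdges X + pairsBelow missing missing X
  nonEdges² X = trans (∑ᶠ-product g g) (cong₂ _+_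
    (∑-cong (allFin n) idem)
    (∑-cong (allFin n) (λ a → ∑-cong (allFin n) (λ c → cong (δ̄ a c *_)
      (rearrange (mem a X) (nonEdge (tog a X)) (mem c X) (nonEdge (tog c X)))))))
    where
    g : Fin n → ℕ
    g c = mem c X * nonEdge (tog c X)
    rearrange : ∀ x y z w → x * y * (z * w) ≡ x * w * (z * y)
    rearrange = solve-∀
    idem : ∀ c → g c * g c ≡ g c
    idem c = trans (square (mem c X) (nonEdge (tog c X)))
      (cong₂ _*_ (ι-idem (lookup X c)) (ι-idem (does (∣ tog c X ∣ ≟ k) ∧ isNone (edge H (tog c X)))))
      where
      square : ∀ x y → x * y * (x * y) ≡ x * x * (y * y)
      square = solve-∀

  -- An edge X - c has at most one head a, hence lies in at most one pair; the condition on X - a is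
  -- dropped.
  pairs-head≤directeds : ∀ X → pairsBelow headAt headAt X ≤ directeds X
  pairs-head≤directeds X = begin
    pairsBelow headAt headAt X
      ≡⟨ ∑-swap (allFin n) (allFin n) _ ⟩
    ∑ᶠ (λ c → ∑ᶠ (λ a → δ̄ a c * ((mem a X * headAt (tog c X) a) * (mem c X * headAt (tog a X) c))))
      ≤⟨ ∑-mono (allFin n) (λ c → ∑-mono (allFin n) (λ a →
           bound (not (does (a F.≟ c))) (lookup X a) (lookup X c)
             (pointsTo (edge H (tog a X)) c) (headAt (tog c X) a))) ⟩
    ∑ᶠ (λ c → ∑ᶠ (λ a → mem c X * headAt (tog c X) a))
      ≡⟨ ∑-cong (allFin n) (λ c → trans (∑-*ˡ (allFin n) (mem c X) _)
           (cong (mem c X *_) (∑-headAt (tog c X)))) ⟩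
    directeds X ∎
    where
    open ≤-Reasoning
    bound : ∀ p q r s h → ι p * ((ι q * h) * (ι r * ι s)) ≤ ι r * h
    bound p q false s h rewrite *-zeroʳ (ι q * h) | *-zeroʳ (ι p) = z≤n
    bound p q true  s h = begin
      ι p * ((ι q * h) * (1 * ι s))  ≤⟨ ι*≤ p _ ⟩
      (ι q * h) * (1 * ι s)
        ≤⟨ *-mono-≤ (ι*≤ q h) (≤-trans (≤-reflexive (*-identityˡ (ι s))) (ι≤1 s)) ⟩
      h * 1                          ≡⟨ *-comm h 1 ⟩
      1 * h                          ∎

  -- Crude, but enough to show that a set X without non-edges has no mixed pairs.
  pairs-mixed≤nonEdges : ∀ X → pairsBelow headAt missing X ≤ n * nonEdges X
  pairs-mixed≤nonEdges X = begin
    pairsBelow headAt missing X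
      ≤⟨ ∑-mono (allFin n) (λ a → ∑-mono (allFin n) (λ c →
           bound (not (does (a F.≟ c))) (lookup X a) (pointsTo (edge H (tog c X)) a)
             (lookup X c) (nonEdge (tog a X)))) ⟩
    ∑ᶠ {n} (λ a → ∑ᶠ {n} (λ c → mem a X * nonEdge (tog a X)))
      ≡⟨ ∑-swap (allFin n) (allFin n) _ ⟩
    ∑ᶠ {n} (λ c → nonEdges X)
      ≡⟨ ∑ᶠ-const {n} (nonEdges X) ⟩
    n * nonEdges X ∎
    where
    open ≤-Reasoning
    bound : ∀ p q s r h → ι p * ((ι q * ι s) * (ι r * h)) ≤ ι q * h
    bound p false s r h rewrite *-zeroʳ (ι p) = z≤n
    bound p true  s r h = begin
      ι p * ((1 * ι s) * (ι r * h))  ≤⟨ ι*≤ p _ ⟩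
      (1 * ι s) * (ι r * h)
        ≤⟨ *-mono-≤ (≤-trans (≤-reflexive (*-identityˡ (ι s))) (ι≤1 s)) (ι*≤ r h) ⟩
      1 * h                          ∎

  headAt⇒≢ : ∀ X {a c} → lookup X c ≡ true → edge H (tog c X) ≡ dir a → a ≢ c
  headAt⇒≢ X {a} {c} c∈X eq = ∈tog⇒≢ X c∈X (Vec.[]=⇒lookup (headIn H (tog c X) a eq))

  headAt⇒∈ : ∀ X {a c} → lookup X c ≡ true → edge H (tog c X) ≡ dir a → lookup X a ≡ true
  headAt⇒∈ X {a} {c} c∈X eq = ∈tog⇒∈ X c∈X (Vec.[]=⇒lookup (headIn H (tog c X) a eq))

  -- A third edge X - b would complete a T_k, so the summand at b is at most the sum of the
  -- indicators of b = a and b = c.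
  edges≤2 : TFree k H → ∀ X {a c} → ∣ X ∣ ≡ suc k → lookup X c ≡ true → edge H (tog c X) ≡ dir a →
            HasEdge (edge H (tog a X)) → directeds X + undirecteds X ≤ 2
  edges≤2 free X {a} {c} ∣X∣ c∈X X-c→a X-a = begin
    directeds X + undirecteds X
      ≡⟨ edges≡ X ⟨
    ∑ᶠ (λ b → mem b X * (directed (tog b X) + undirected (tog b X)))
      ≤⟨ ∑-mono (allFin n) support ⟩
    ∑ᶠ (λ b → δ a b + δ c b)
      ≡⟨ ∑-+ (allFin n) (δ a) (δ c) ⟩
    ∑ᶠ (δ a) + ∑ᶠ (δ c)
      ≡⟨ cong₂ _+_ (∑ᶠ-δ a) (∑ᶠ-δ c) ⟩
    2 ∎
    where
    open ≤-Reasoning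
    thirdEdge : ∀ {b} → lookup X b ≡ true → a ≢ b → c ≢ b → HasEdge (edge H (tog b X)) → ContainsT k H
    thirdEdge b∈X a≢b c≢b = containsT H X ∣X∣ (headAt⇒∈ X c∈X X-c→a) b∈X c∈X (≢-sym a≢b) (≢-sym c≢b)
      (headAt⇒≢ X c∈X X-c→a) X-c→a X-a
    edge≤1 : ∀ b → mem b X * (directed (tog b X) + undirected (tog b X)) ≤ 1
    edge≤1 b = ≤-trans (ι*≤ (lookup X b) _)
      (≤-trans (m≤n+m _ (nonEdge (tog b X))) (≤-trans (≤-reflexive (trichotomy (tog b X))) (ι≤1 _)))
    support : ∀ b → mem b X * (directed (tog b X) + undirected (tog b X)) ≤ δ a b + δ c b
    support b with a F.≟ b | c F.≟ b
    ... | yes _  | _      = ≤-trans (edge≤1 b) (s≤s z≤n)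
    ... | no _   | yes _  = edge≤1 b
    ... | no a≢b | no c≢b with lookup X b in b∈X
    ...   | false = z≤n
    ...   | true with edge H (tog b X) in eb
    ...     | none  = z≤n
    ...     | und   = contradiction (thirdEdge b∈X a≢b c≢b (λ e → case trans (sym eb) e of λ ())) free
    ...     | dir _ = contradiction (thirdEdge b∈X a≢b c≢b (λ e → case trans (sym eb) e of λ ())) free

  HeadsOnNonEdges : Subset n → Set
  HeadsOnNonEdges X =
    ∀ c a → lookup X c ≡ true → edge H (tog c X) ≡ dir a → isNone (edge H (tog a X)) ≡ true

  -- If X - c is directed toward a, then X - a is a non-edge and cannot be directed toward c.
  pairs-head≡0 : ∀ X → HeadsOnNonEdges X → pairsBelow headAt headAt X ≡ 0
  pairs-head≡0 X heads = trans
    (∑-cong (allFin n) (λ a → trans (∑-cong (allFin n) (zero-term a)) (∑-0 (allFin n)))) (∑-0 (allFin n))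
    where
    zero-term : ∀ a c → δ̄ a c * ((mem a X * headAt (tog c X) a) * (mem c X * headAt (tog a X) c)) ≡ 0
    zero-term a c with lookup X c in c∈X | pointsTo (edge H (tog c X)) a in X-c→a
    ... | false | p     rewrite *-zeroʳ (mem a X * ι p) = *-zeroʳ (δ̄ a c)
    ... | true  | false rewrite *-zeroʳ (mem a X) = *-zeroʳ (δ̄ a c)
    ... | true  | true  with edge H (tog a X) | heads c a c∈X (pointsTo⇒≡dir _ X-c→a)
    ...   | none | _ rewrite *-zeroʳ (mem a X * 1) = *-zeroʳ (δ̄ a c)

  directeds≤mixed : ∀ X → ∣ X ∣ ≡ suc k → HeadsOnNonEdges X → directeds X ≤ pairsBelow headAt missing X
  directeds≤mixed X ∣X∣ heads = begin
    directeds X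
      ≤⟨ ∑-mono (allFin n) row ⟩
    ∑ᶠ (λ c → ∑ᶠ (λ a → δ̄ a c * ((mem a X * headAt (tog c X) a) * (mem c X * nonEdge (tog a X)))))
      ≡⟨ ∑-swap (allFin n) (allFin n) _ ⟩
    pairsBelow headAt missing X ∎
    where
    open ≤-Reasoning
    row : ∀ c → mem c X * directed (tog c X)
              ≤ ∑ᶠ (λ a → δ̄ a c * ((mem a X * headAt (tog c X) a) * (mem c X * nonEdge (tog a X))))
    row c with lookup X c in c∈X
    ... | false = z≤n
    ... | true with edge H (tog c X) in X-c→
    ...   | none  = z≤n
    ...   | und   = z≤n
    -- The head a alone contributes one. That X has k + 1 elements lets X - a pass the size test in
    -- `nonEdge`.
    ...   | dir a = ≤-trans (≤-reflexive (sym one))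
              (term≤∑ᶠ a (λ a' → δ̄ a' c * ((mem a' X * ι (does (a F.≟ a'))) * (1 * nonEdge (tog a' X)))))
      where
      one : δ̄ a c * ((mem a X * ι (does (a F.≟ a))) * (1 * nonEdge (tog a X))) ≡ 1
      one with a F.≟ c | a F.≟ a
      ... | yes a≡c | _      = contradiction a≡c (headAt⇒≢ X c∈X X-c→)
      ... | _       | no a≢a = contradiction refl a≢a
      ... | no _    | yes _
        rewrite headAt⇒∈ X c∈X X-c→ | heads c a c∈X X-c→
              | dec-true (∣ tog a X ∣ ≟ k)
                  (suc-injective (trans (sym (∣tog∣ a X (headAt⇒∈ X c∈X X-c→))) ∣X∣)) = refl

total-full : ∀ {k n} (H : PDG k n) X → ∣ X ∣ ≡ suc k →
            nonEdges H X + (directeds H X + undirecteds H X) ≡ suc k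
total-full {k} H X ∣X∣ = trans (total-size H X)
  (trans (cong (λ b → ∣ X ∣ * ι b) (dec-true (∣ X ∣ ≟ suc k) ∣X∣)) (trans (*-identityʳ ∣ X ∣) ∣X∣))

balanced : ∀ t {n} (H : PDG (4 + t) n) → TFree (4 + t) H → ∀ X →
  Balanced t (nonEdges H X) (directeds H X) (pairsBelow (headAt H) (headAt H) X)
             (pairsBelow (headAt H) (missing H) X) (pairsBelow (missing H) (missing H) X)
balanced t {n} H free X with ∣ X ∣ ≟ 5 + t
... | no ∣X∣≢ = balanced-empty t (nonEdges H X)
  (pairsBelow (headAt H) (missing H) X) (pairsBelow (missing H) (missing H) X)
  (m+n≡0⇒m≡0 _ total≡0) (m+n≡0⇒m≡0 _ (m+n≡0⇒n≡0 (nonEdges H X) total≡0))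
  (pairs-head≤directeds H X) (nonEdges² H X)
  where
  total≡0 : nonEdges H X + (directeds H X + undirecteds H X) ≡ 0
  total≡0 = trans (total-size H X)
    (trans (cong (λ b → ∣ X ∣ * ι b) (dec-false (∣ X ∣ ≟ 5 + t) ∣X∣≢)) (*-zeroʳ ∣ X ∣))
... | yes ∣X∣
  -- A finite search over Boolean tests decides the dichotomy constructively; a ∈ X and a ≠ c come
  -- from `headIn`.
  with any? (λ c → any? (λ a → (lookup X c Bool.≟ true) ×-dec
         ((pointsTo (edge H (tog c X)) a Bool.≟ true) ×-dec (isNone (edge H (tog a X)) Bool.≟ false))))
...   | yes (c , a , c∈X , X-c→a , X-a) =
  balanced-fewEdges t (nonEdges H X) (directeds H X + undirecteds H X) (directeds H X)
    (pairsBelow (headAt H) (missing H) X) (pairsBelow (missing H) (missing H) X) (total-full H X ∣X∣)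
    (edges≤2 H free X ∣X∣ c∈X (pointsTo⇒≡dir _ X-c→a) (isNone≡false⇒HasEdge X-a))
    (m≤m+n _ _) (pairs-head≤directeds H X) (nonEdges² H X)
...   | no ∄ =
  balanced-headsOnNonEdges t n (nonEdges H X) (directeds H X) (undirecteds H X)
    (pairsBelow (headAt H) (missing H) X) (pairsBelow (missing H) (missing H) X)
    (total-full H X ∣X∣) (pairs-head≡0 H X heads)
    (directeds≤mixed H X ∣X∣ heads) (pairs-mixed≤nonEdges H X) (nonEdges² H X)
  where
  heads : HeadsOnNonEdges H X
  heads c a c∈X X-c→a with isNone (edge H (tog a X)) in X-a
  ... | true  = refl
  ... | false = contradiction (c , a , c∈X , points , X-a) ∄
    where
    points : pointsTo (edge H (tog c X)) a ≡ true
    points rewrite X-c→a = dec-true (a F.≟ a) refl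

-- Summation over all subsets

module _ {k n : ℕ} (H : PDG k n) where

  #none #dir #und : ℕ
  #none = ∑ˢ (nonEdge H)
  #dir  = ∑ˢ (directed H)
  #und  = ∑ˢ (undirected H)

  #total : #none + (#dir + #und) ≡ n C k
  #total = begin
    #none + (#dir + #und)
      ≡⟨ cong (#none +_) (∑-+ (allSubsets n) (directed H) (undirected H)) ⟨
    #none + ∑ˢ (λ S → directed H S + undirected H S)
      ≡⟨ ∑-+ (allSubsets n) (nonEdge H) _ ⟨
    ∑ˢ (λ S → nonEdge H S + (directed H S + undirected H S))
      ≡⟨ ∑-cong (allSubsets n) (trichotomy H) ⟩
    ∑ˢ (sizeK H)
      ≡⟨ ∑ˢ-size n k ⟩
    n C k ∎
    where open ≡-Reasoning

  Supported : (Subset n → ℕ) → Set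
  Supported g = ∀ S → ∣ S ∣ ≢ k → g S ≡ 0

  nonEdge-supported : Supported (nonEdge H)
  nonEdge-supported S ≢k rewrite dec-false (∣ S ∣ ≟ k) ≢k = refl

  directed-supported : Supported (directed H)
  directed-supported S ≢k rewrite onlyK H S ≢k = refl

  ∑ˢ-weighted : ∀ {r} (s : Subset n → ℕ) {g} → Supported g → (∀ S → ∣ S ∣ ≡ k → s S ≡ r) →
                ∑ˢ (λ S → s S * g S) ≡ r * ∑ˢ g
  ∑ˢ-weighted {r} s {g} supp s≡r = trans (∑-cong (allSubsets n) pointwise) (∑-*ˡ (allSubsets n) r g)
    where
    pointwise : ∀ S → s S * g S ≡ r * g S
    pointwise S with ∣ S ∣ ≟ k
    ... | yes ≡k = cong (_* g S) (s≡r S ≡k)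
    ... | no ≢k rewrite supp S ≢k = trans (*-zeroʳ (s S)) (sym (*-zeroʳ r))

  -- Each k-set S equals X - c for exactly M sets X, one for each vertex c outside S.
  ∑ˢ-removals : ∀ {M g} → n ≡ k + M → Supported g →
    ∑ˢ (λ X → ∑ᶠ (λ c → mem c X * g (tog c X))) ≡ M * ∑ˢ g
  ∑ˢ-removals {M} {g} n≡k+M supp = trans (∑ˢ-remove g) (∑ˢ-weighted _ supp complement)
    where
    complement : ∀ S → ∣ S ∣ ≡ k → ∑ᶠ (λ c → out c S) ≡ M
    complement S refl = +-cancelˡ-≡ k _ M (trans (∑-mem-out S) n≡k+M)

  -- These are f(L) and ν(L). Both vanish unless L has k - 1 elements, since otherwise no L + a is a
  -- k-set.
  heads nones : Subset n → ℕ
  heads L = ∑ᶠ (λ a → out a L * headAt H (tog a L) a)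
  nones L = ∑ᶠ (λ a → out a L * nonEdge H (tog a L))

  -- A directed edge is counted only at the set L left by deleting its head.
  ∑-heads : ∑ˢ heads ≤ #dir
  ∑-heads = begin
    ∑ˢ heads
      ≡⟨ ∑ˢ-add (headAt H) ⟩
    ∑ˢ (λ S → ∑ᶠ (λ a → mem a S * headAt H S a))
      ≤⟨ ∑-mono (allSubsets n) (λ S → ∑-mono (allFin n) (λ a → ι*≤ (lookup S a) _)) ⟩
    ∑ˢ (λ S → ∑ᶠ (headAt H S))
      ≡⟨ ∑-cong (allSubsets n) (∑-headAt H) ⟩
    #dir ∎
    where
    open ≤-Reasoning

  -- A non-edge S is counted at each of its k subsets S - a. Like the sum of heads, this lacks the
  -- factor M of the main terms.
  ∑-nones : ∑ˢ nones ≡ k * #none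
  ∑-nones = begin
    ∑ˢ nones
      ≡⟨ ∑ˢ-add (missing H) ⟩
    ∑ˢ (λ S → ∑ᶠ (λ a → mem a S * nonEdge H S))
      ≡⟨ ∑-cong (allSubsets n) (λ S → trans (∑-*ʳ (allFin n) _ (nonEdge H S))
           (cong (_* nonEdge H S) (∑-mem S))) ⟩
    ∑ˢ (λ S → ∣ S ∣ * nonEdge H S)
      ≡⟨ ∑ˢ-weighted ∣_∣ nonEdge-supported (λ _ eq → eq) ⟩
    k * #none ∎
    where open ≡-Reasoning

  square-above : (b : Subset n → Fin n → Bool) (L : Subset n) →
    let g = λ a → out a L * ι (b (tog a L) a) in
    ∑ᶠ g * ∑ᶠ g ≡ ∑ᶠ g + pairsAbove (λ S a → ι (b S a)) (λ S a → ι (b S a)) L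
  square-above b L = trans (∑ᶠ-product g g)
    (cong (_+ pairsAbove (λ S a → ι (b S a)) (λ S a → ι (b S a)) L) (∑-cong (allFin n) idem))
    where
    g : Fin n → ℕ
    g a = out a L * ι (b (tog a L) a)
    square : ∀ x y → x * y * (x * y) ≡ x * x * (y * y)
    square = solve-∀
    idem : ∀ a → g a * g a ≡ g a
    idem a = trans (square (out a L) _) (cong₂ _*_ (ι-idem (not (lookup L a))) (ι-idem (b (tog a L) a)))

  AM-GM-above : ∀ w L →
    10 * w * pairsAbove (headAt H) (missing H) L
    ≤ w * w * (heads L + pairsAbove (headAt H) (headAt H) L)
      + 25 * (nones L + pairsAbove (missing H) (missing H) L)
  AM-GM-above w L = begin
    10 * w * pairsAbove (headAt H) (missing H) L
      -- The diagonal of the product is dropped; it is zero anyway, as L + a is not both directed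
      -- and a non-edge.
      ≤⟨ *-monoʳ-≤ (10 * w) (m+n≤o⇒n≤o _ (≤-reflexive (sym (∑ᶠ-product
           (λ a → out a L * headAt H (tog a L) a) (λ a → out a L * nonEdge H (tog a L)))))) ⟩
    10 * w * (heads L * nones L)
      ≤⟨ weighted-AM-GM w (heads L) (nones L) ⟩
    w * w * (heads L * heads L) + 25 * (nones L * nones L)
      ≡⟨ cong₂ (λ x y → w * w * x + 25 * y)
           (square-above (λ S a → pointsTo (edge H S) a) L)
           (square-above (λ S _ → does (∣ S ∣ ≟ k) ∧ isNone (edge H S)) L) ⟩
    w * w * (heads L + pairsAbove (headAt H) (headAt H) L)
      + 25 * (nones L + pairsAbove (missing H) (missing H) L) ∎
    where open ≤-Reasoning

  HH HN NN : ℕ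
  HH = ∑ˢ (pairsBelow (headAt H) (headAt H))
  HN = ∑ˢ (pairsBelow (headAt H) (missing H))
  NN = ∑ˢ (pairsBelow (missing H) (missing H))

  ∑-AM-GM : ∀ w → 10 * w * HN ≤ w * w * (#dir + HH) + 25 * (k * #none + NN)
  ∑-AM-GM w = begin
    10 * w * HN
      ≡⟨ cong (10 * w *_) (∑ˢ-pairs (headAt H) (missing H)) ⟨
    10 * w * ∑ˢ (pairsAbove (headAt H) (missing H))
      ≡⟨ ∑-*ˡ (allSubsets n) (10 * w) (pairsAbove (headAt H) (missing H)) ⟨
    ∑ˢ (λ L → 10 * w * pairsAbove (headAt H) (missing H) L)
      ≤⟨ ∑-mono (allSubsets n) (AM-GM-above w) ⟩
    ∑ˢ (λ L → w * w * (heads L + pairsAbove (headAt H) (headAt H) L)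
            + 25 * (nones L + pairsAbove (missing H) (missing H) L))
      ≡⟨ ∑-+ (allSubsets n) (λ L → w * w * (heads L + pairsAbove (headAt H) (headAt H) L))
           (λ L → 25 * (nones L + pairsAbove (missing H) (missing H) L)) ⟩
    ∑ˢ (λ L → w * w * (heads L + pairsAbove (headAt H) (headAt H) L))
      + ∑ˢ (λ L → 25 * (nones L + pairsAbove (missing H) (missing H) L))
      ≡⟨ cong₂ _+_ (linear (w * w) heads (headAt H)) (linear 25 nones (missing H)) ⟩
    w * w * (∑ˢ heads + HH) + 25 * (∑ˢ nones + NN)
      ≤⟨ +-mono-≤ (*-monoʳ-≤ (w * w) (+-monoˡ-≤ HH ∑-heads))
           (≤-reflexive (cong (λ x → 25 * (x + NN)) ∑-nones)) ⟩
    w * w * (#dir + HH) + 25 * (k * #none + NN) ∎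
    where
    open ≤-Reasoning
    linear : ∀ r g p → ∑ˢ (λ L → r * (g L + pairsAbove p p L)) ≡ r * (∑ˢ g + ∑ˢ (pairsBelow p p))
    linear r g p = trans (∑-*ˡ (allSubsets n) r (λ L → g L + pairsAbove p p L))
      (cong (r *_) (trans (∑-+ (allSubsets n) g (pairsAbove p p)) (cong (_ +_) (∑ˢ-pairs p p))))

-- `Balanced` is linear in its five counts, so it survives summation over X; m and e acquire the
-- factor M by `∑ˢ-removals`.
∑-balanced : ∀ t {n M} (H : PDG (4 + t) n) → TFree (4 + t) H → n ≡ (4 + t) + M →
  Balanced t (M * #none H) (M * #dir H) (HH H) (HN H) (NN H)
∑-balanced t {n} {M} H free n≡ = subst₂ _≤_ lhs rhs (∑-mono (allSubsets n) (balanced t H free))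
  where
  w = 7 + 3 * t
  lhs : ∑ˢ (λ X → 30 * (4 + t) * directeds H X + w * w * pairsBelow (headAt H) (headAt H) X
                  + 25 * pairsBelow (missing H) (missing H) X)
      ≡ 30 * (4 + t) * (M * #dir H) + w * w * HH H + 25 * NN H
  lhs = trans (∑-+ (allSubsets n)
           (λ X → 30 * (4 + t) * directeds H X + w * w * pairsBelow (headAt H) (headAt H) X) _)
    (cong₂ _+_
      (trans (∑-+ (allSubsets n) (λ X → 30 * (4 + t) * directeds H X) _)
        (cong₂ _+_
          (trans (∑-*ˡ (allSubsets n) (30 * (4 + t)) (directeds H))
            (cong (30 * (4 + t) *_) (∑ˢ-removals H n≡ (directed-supported H))))
          (∑-*ˡ (allSubsets n) (w * w) (pairsBelow (headAt H) (headAt H)))))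
      (∑-*ˡ (allSubsets n) 25 (pairsBelow (missing H) (missing H))))
  rhs : ∑ˢ (λ X → 50 * (4 + t) * nonEdges H X + 10 * w * pairsBelow (headAt H) (missing H) X)
      ≡ 50 * (4 + t) * (M * #none H) + 10 * w * HN H
  rhs = trans (∑-+ (allSubsets n) (λ X → 50 * (4 + t) * nonEdges H X) _)
    (cong₂ _+_
      (trans (∑-*ˡ (allSubsets n) (50 * (4 + t)) (nonEdges H))
        (cong (50 * (4 + t) *_) (∑ˢ-removals H n≡ (nonEdge-supported H))))
      (∑-*ˡ (allSubsets n) (10 * w) (pairsBelow (headAt H) (missing H))))

-- As 5 U + 8 D = 5 (U + D) + 3 D, it suffices to replace 3 D by 5 N at the cost of the diagonal
-- terms.
density-bound : ∀ t {n M} (H : PDG (4 + t) n) → TFree (4 + t) H → n ≡ (4 + t) + M →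
  10 * (4 + t) * M * (5 * #und H + 8 * #dir H)
  ≤ 50 * (4 + t) * M * (n C (4 + t)) + ((7 + 3 * t) * (7 + 3 * t) + 25 * (4 + t)) * (n C (4 + t))
density-bound t {n} {M} H free n≡ = begin
  10 * k * M * (5 * U + 8 * D)
    ≡⟨ expand k M U D ⟩
  50 * k * M * (D + U) + 30 * k * (M * D)
    ≤⟨ +-monoʳ-≤ (50 * k * M * (D + U)) cancelled ⟩
  50 * k * M * (D + U) + (50 * k * (M * N) + (w * w * D + 25 * k * N))
    ≡⟨ collect k M U D N (w * w * D + 25 * k * N) ⟩
  50 * k * M * (N + (D + U)) + (w * w * D + 25 * k * N)
    ≤⟨ +-monoʳ-≤ (50 * k * M * (N + (D + U))) (+-mono-≤
         (*-monoʳ-≤ (w * w) (≤-trans (m≤m+n D U) (m≤n+m (D + U) N)))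
         (*-monoʳ-≤ (25 * k) (m≤m+n N (D + U)))) ⟩
  50 * k * M * (N + (D + U)) + (w * w * (N + (D + U)) + 25 * k * (N + (D + U)))
    ≡⟨ cong (50 * k * M * (N + (D + U)) +_) (*-distribʳ-+ (N + (D + U)) (w * w) (25 * k)) ⟨
  50 * k * M * (N + (D + U)) + (w * w + 25 * k) * (N + (D + U))
    ≡⟨ cong (λ c → 50 * k * M * c + (w * w + 25 * k) * c) (#total H) ⟩
  50 * k * M * (n C k) + (w * w + 25 * k) * (n C k) ∎
  where
  open ≤-Reasoning
  k w N D U : ℕ
  k = 4 + t
  w = 7 + 3 * t
  N = #none H
  D = #dir H
  U = #und H
  expand : ∀ k M U D → 10 * k * M * (5 * U + 8 * D) ≡ 50 * k * M * (D + U) + 30 * k * (M * D)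
  expand = solve-∀
  collect : ∀ k M U D N r → 50 * k * M * (D + U) + (50 * k * (M * N) + r) ≡ 50 * k * M * (N + (D + U)) + r
  collect = solve-∀
  regroup : ∀ k w M D N p q →
    50 * k * (M * N) + (w * w * (D + p) + 25 * (k * N + q))
    ≡ (50 * k * (M * N) + (w * w * D + 25 * k * N)) + (w * w * p + 25 * q)
  regroup = solve-∀
  -- `HN` bounds the local side from above and is itself bounded by the squares; once the two are
  -- chained, `HH` and `NN` stand on both sides and cancel.
  cancelled : 30 * k * (M * D) ≤ 50 * k * (M * N) + (w * w * D + 25 * k * N)
  cancelled = +-cancelʳ-≤ (w * w * HH H + 25 * NN H) _ _ (begin
    30 * k * (M * D) + (w * w * HH H + 25 * NN H)
      ≡⟨ +-assoc (30 * k * (M * D)) (w * w * HH H) (25 * NN H) ⟨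
    30 * k * (M * D) + w * w * HH H + 25 * NN H
      ≤⟨ ∑-balanced t H free n≡ ⟩
    50 * k * (M * N) + 10 * w * HN H
      ≤⟨ +-monoʳ-≤ (50 * k * (M * N)) (∑-AM-GM H w) ⟩
    50 * k * (M * N) + (w * w * (D + HH H) + 25 * (k * N + NN H))
      ≡⟨ regroup k w M D N (HH H) (NN H) ⟩
    (50 * k * (M * N) + (w * w * D + 25 * k * N)) + (w * w * HH H + 25 * NN H) ∎)

-- Passage to rational ε

clear-denominators : ∀ k M K q p x c .{{_ : NonZero k}} .{{_ : NonZero M}} .{{_ : NonZero p}} →
  10 * k * M * x ≤ 50 * k * M * c + K * c → K * q ≤ M → q * x ≤ 5 * (q + p) * c
clear-denominators k@(suc _) M@(suc _) K q p@(suc p-1) x c bound Kq≤M = *-cancelˡ-≤ (10 * k * M) (begin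
  10 * k * M * (q * x)
    ≡⟨ left (10 * k * M) q x ⟩
  q * (10 * k * M * x)
    ≤⟨ *-monoʳ-≤ q bound ⟩
  q * (50 * k * M * c + K * c)
    ≡⟨ middle k M K q c ⟩
  50 * k * M * q * c + K * q * c
    -- The error fits into the room left by ε = p / q: K q c ≤ M c ≤ 50 k p M c, as p is positive.
    ≤⟨ +-monoʳ-≤ (50 * k * M * q * c) (*-monoˡ-≤ c (≤-trans Kq≤M (m≤n*m M (50 * k * p)))) ⟩
  50 * k * M * q * c + 50 * k * p * M * c
    ≡⟨ right k M q p c ⟩
  10 * k * M * (5 * (q + p) * c) ∎)
  where
  open ≤-Reasoning
  left : ∀ r q x → r * (q * x) ≡ q * (r * x)
  left = solve-∀
  middle : ∀ k M K q c → q * (50 * k * M * c + K * c) ≡ 50 * k * M * q * c + K * q * c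
  middle = solve-∀
  right : ∀ k M q p c → 50 * k * M * q * c + 50 * k * p * M * c ≡ 10 * k * M * (5 * (q + p) * c)
  right = solve-∀

θ : ℚ
θ = ℤ.+ 8 ℚ./ 5

toℚᵘ-ℕtoℚ : ∀ m → toℚᵘ (ℕtoℚ m) ℚᵘ.≃ mkℚᵘ (ℤ.+ m) 0
toℚᵘ-ℕtoℚ m = ℚ.toℚᵘ-fromℚᵘ (mkℚᵘ (ℤ.+ m) 0)

fromℕ-bound : ∀ u d c p q-1 .(coprime : Coprime p (suc q-1)) → let ε = mkℚ (ℤ.+ p) q-1 coprime in
  suc q-1 * (5 * u + 8 * d) ≤ 5 * (suc q-1 + p) * c →
  ℕtoℚ u ℚ.+ θ ℚ.* ℕtoℚ d ℚ.≤ (1ℚ ℚ.+ ε) ℚ.* ℕtoℚ c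
fromℕ-bound u d c p q-1 coprime le = ℚ.toℚᵘ-cancel-≤
  (ℚᵘ.≤-respˡ-≃ (ℚᵘ.≃-sym lhs) (ℚᵘ.≤-respʳ-≃ (ℚᵘ.≃-sym rhs) (*≤* (subst₂ ℤ._≤_ lhsℤ rhsℤ (ℤ.+≤+ le′)))))
  where
  ε = mkℚ (ℤ.+ p) q-1 coprime
  lhs : toℚᵘ (ℕtoℚ u ℚ.+ θ ℚ.* ℕtoℚ d) ℚᵘ.≃ mkℚᵘ (ℤ.+ u) 0 ℚᵘ.+ mkℚᵘ (ℤ.+ 8) 4 ℚᵘ.* mkℚᵘ (ℤ.+ d) 0
  lhs = ℚᵘ.≃-trans (ℚ.toℚᵘ-homo-+ (ℕtoℚ u) (θ ℚ.* ℕtoℚ d)) (ℚᵘ.+-cong (toℚᵘ-ℕtoℚ u)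
    (ℚᵘ.≃-trans (ℚ.toℚᵘ-homo-* θ (ℕtoℚ d)) (ℚᵘ.*-congˡ {mkℚᵘ (ℤ.+ 8) 4} (toℚᵘ-ℕtoℚ d))))
  rhs : toℚᵘ ((1ℚ ℚ.+ ε) ℚ.* ℕtoℚ c) ℚᵘ.≃ (mkℚᵘ (ℤ.+ 1) 0 ℚᵘ.+ mkℚᵘ (ℤ.+ p) q-1) ℚᵘ.* mkℚᵘ (ℤ.+ c) 0
  rhs = ℚᵘ.≃-trans (ℚ.toℚᵘ-homo-* (1ℚ ℚ.+ ε) (ℕtoℚ c))
    (ℚᵘ.*-cong (ℚ.toℚᵘ-homo-+ 1ℚ ε) (toℚᵘ-ℕtoℚ c))
  -- The factors 1 reproduce the cross-multiplication of the unnormalised fractions.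
  le′ : (u * 5 + 8 * d * 1) * (1 * suc q-1 * 1) ≤ ((1 * suc q-1 + p * 1) * c) * (1 * (5 * 1))
  le′ = subst₂ _≤_ (l u d (suc q-1)) (r p c (suc q-1)) le
    where
    l : ∀ u d q → q * (5 * u + 8 * d) ≡ (u * 5 + 8 * d * 1) * (1 * q * 1)
    l = solve-∀
    r : ∀ p c q → 5 * (q + p) * c ≡ ((1 * q + p * 1) * c) * (1 * (5 * 1))
    r = solve-∀
  lhsℤ : ℤ.+ ((u * 5 + 8 * d * 1) * (1 * suc q-1 * 1))
       ≡ (ℤ.+ u ℤ.* ℤ.+ 5 ℤ.+ (ℤ.+ 8 ℤ.* ℤ.+ d) ℤ.* ℤ.+ 1) ℤ.* ℤ.+ (1 * suc q-1 * 1)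
  lhsℤ = trans (ℤ.pos-* (u * 5 + 8 * d * 1) (1 * suc q-1 * 1)) (cong (ℤ._* ℤ.+ (1 * suc q-1 * 1))
    (cong₂ ℤ._+_ (ℤ.pos-* u 5) (trans (ℤ.pos-* (8 * d) 1) (cong (ℤ._* ℤ.+ 1) (ℤ.pos-* 8 d)))))
  rhsℤ : ℤ.+ (((1 * suc q-1 + p * 1) * c) * (1 * (5 * 1)))
       ≡ ((ℤ.+ 1 ℤ.* ℤ.+ suc q-1 ℤ.+ ℤ.+ p ℤ.* ℤ.+ 1) ℤ.* ℤ.+ c) ℤ.* ℤ.+ (1 * (5 * 1))
  rhsℤ = trans (ℤ.pos-* ((1 * suc q-1 + p * 1) * c) 5) (cong (ℤ._* ℤ.+ 5)
    (trans (ℤ.pos-* (1 * suc q-1 + p * 1) c) (cong (ℤ._* ℤ.+ c)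
      (cong₂ ℤ._+_ (ℤ.pos-* 1 (suc q-1)) (ℤ.pos-* p 1)))))

upper : ∀ t → UpperBound (4 + t) θ 1ℚ
upper t ε@(mkℚ ℤ.-[1+ _ ] _ _) 0<ε with ℚ.positive 0<ε
... | ()
upper t ε@(mkℚ (ℤ.+ zero) _ _) 0<ε with ℚ.positive 0<ε
... | ()
upper t (mkℚ (ℤ.+ suc p-1) q-1 coprime) 0<ε = 4 + t + M₀ , bound
  where
  K M₀ : ℕ
  K  = (7 + 3 * t) * (7 + 3 * t) + 25 * (4 + t)
  -- Large enough for K q ≤ M; the successor makes `M₀ + o` visibly nonzero.
  M₀ = suc (K * suc q-1)
  bound : ∀ n → 4 + t + M₀ ≤ n → (H : PDG (4 + t) n) → TFree (4 + t) H →
    ℕtoℚ (eu H) ℚ.+ θ ℚ.* ℕtoℚ (ed H) ℚ.≤ (1ℚ ℚ.+ mkℚ (ℤ.+ suc p-1) q-1 coprime) ℚ.* ℕtoℚ (n C (4 + t))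
  bound n large H free with m≤n⇒∃[o]m+o≡n large
  ... | o , refl = fromℕ-bound (eu H) (ed H) (n C (4 + t)) (suc p-1) q-1 coprime
    (clear-denominators (4 + t) (M₀ + o) K (suc q-1) (suc p-1) (5 * eu H + 8 * ed H) (n C (4 + t))
      (subst₂ (λ u d → 10 * (4 + t) * (M₀ + o) * (5 * u + 8 * d)
                       ≤ 50 * (4 + t) * (M₀ + o) * (n C (4 + t)) + K * (n C (4 + t)))
        (sym (countB≡∑ _ (allSubsets n))) (sym (countB≡∑ _ (allSubsets n)))
        (density-bound t H free (+-assoc (4 + t) M₀ o)))
      (≤-trans (n≤1+n (K * suc q-1)) (m≤m+n M₀ o)))

-- The lower bound

completeEdge : ∀ k {n} → Subset n → EType n
completeEdge k S = if does (∣ S ∣ ≟ k) then und else none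

completeEdge≢dir : ∀ k {n} (S : Subset n) v → completeEdge k S ≢ dir v
completeEdge≢dir k S v with does (∣ S ∣ ≟ k)
... | true  = λ ()
... | false = λ ()

completePDG : ∀ k n → PDG k n
completePDG k n = record
  { edge   = completeEdge k
  ; onlyK  = λ S ≢k → cong (λ b → if b then und else none) (dec-false (∣ S ∣ ≟ k) ≢k)
  ; headIn = λ S v eq → contradiction eq (completeEdge≢dir k S v)
  }

complete-free : ∀ k n → TFree k (completePDG k n)
complete-free k n (f , _ , _ , _ , toward) = completeEdge≢dir k (image (λ i → f (eC i))) _ toward

eu-completePDG : ∀ k n → eu (completePDG k n) ≡ n C k
eu-completePDG k n = trans (countB≡∑ _ (allSubsets n))
  (trans (∑-cong (allSubsets n) (λ S → pointwise (does (∣ S ∣ ≟ k)))) (∑ˢ-size n k))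
  where
  pointwise : ∀ b → ι (isUnd {n} (if b then und else none)) ≡ ι b
  pointwise true  = refl
  pointwise false = refl

ed-completePDG : ∀ k n → ed (completePDG k n) ≡ 0
ed-completePDG k n = trans (countB≡∑ _ (allSubsets n))
  (trans (∑-cong (allSubsets n) (λ S → pointwise (does (∣ S ∣ ≟ k)))) (∑-0 (allSubsets n)))
  where
  pointwise : ∀ b → ι (isDir {n} (if b then und else none)) ≡ 0
  pointwise true  = refl
  pointwise false = refl

nCk>0 : ∀ {n k} → k ≤ n → 1 ≤ n C k
nCk>0 {n}     z≤n       = ≤-reflexive (sym (nC0≡1 n))
nCk>0 {suc n} (s≤s {m = k} k≤n) = ≤-trans (nCk>0 k≤n)
  (≤-trans (m≤m+n (n C k) (n C suc k)) (≤-reflexive (nCk+nC[k+1]≡[n+1]C[k+1] n k)))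

ℕtoℚ-positive : ∀ {m} → 1 ≤ m → ℚ.Positive (ℕtoℚ m)
ℕtoℚ-positive {suc m} _ = ℚ.normalize-pos (suc m) 1

-- If c < r < 1, then taking ε = r - c bounds the density of complete graphs by r, although it is 1.
-- The choice n = N + k keeps n C k positive.
lower : ∀ k c → UpperBound k θ c → 1ℚ ℚ.≤ c
lower k c bound = ℚ.≮⇒≥ λ c<1 →
  let r , c<r , r<1 = ℚ.<-dense c<1
      N , below = bound (r ℚ.- c) (subst (ℚ._< r ℚ.- c) (ℚ.+-inverseʳ c) (ℚ.+-monoˡ-< (ℚ.- c) c<r))
      n = N + k
      edges = n C k
      instance positive = ℕtoℚ-positive (nCk>0 (m≤n+m k N))
      open ℚ.≤-Reasoning
  in ℚ.<-irrefl refl (begin-strict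
    ℕtoℚ edges
      ≡⟨ ℚ.+-identityʳ (ℕtoℚ edges) ⟨
    ℕtoℚ edges ℚ.+ θ ℚ.* ℕtoℚ 0
      ≡⟨ cong₂ (λ u d → ℕtoℚ u ℚ.+ θ ℚ.* ℕtoℚ d) (eu-completePDG k n) (ed-completePDG k n) ⟨
    ℕtoℚ (eu (completePDG k n)) ℚ.+ θ ℚ.* ℕtoℚ (ed (completePDG k n))
      ≤⟨ below n (m≤m+n N k) (completePDG k n) (complete-free k n) ⟩
    (c ℚ.+ (r ℚ.- c)) ℚ.* ℕtoℚ edges
      ≡⟨ cong (ℚ._* ℕtoℚ edges) (cancel c r) ⟩
    r ℚ.* ℕtoℚ edges
      <⟨ ℚ.*-monoˡ-<-pos (ℕtoℚ edges) r<1 ⟩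
    1ℚ ℚ.* ℕtoℚ edges
      ≡⟨ ℚ.*-identityˡ (ℕtoℚ edges) ⟩
    ℕtoℚ edges ∎)
  where
  cancel : ∀ c r → c ℚ.+ (r ℚ.- c) ≡ r
  cancel c r = trans (ℚ.+-comm c (r ℚ.- c)) (trans (ℚ.+-assoc r (ℚ.- c) c)
    (trans (cong (r ℚ.+_) (ℚ.+-inverseˡ c)) (ℚ.+-identityʳ r)))

theorem2p6 : Σ ℚ λ θ → Log₂3< θ × ((k : ℕ) → 4 ≤ k → PiEqOne k θ)
-- The pair 8, 4 encodes 8 / suc 4; exceeding log_2 3 then means 3^5 = 243 < 256 = 2^8.
theorem2p6 = θ , (8 , 4 , refl , from-yes (3 ^ 5 <? 2 ^ 8)) , pi
  where
  pi : (k : ℕ) → 4 ≤ k → PiEqOne k θ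
  pi k 4≤k with m≤n⇒∃[o]m+o≡n 4≤k
  ... | t , refl = upper t , lower (4 + t)
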